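{- With respect to the class of all frames that are forward, backward, downward and upward confluent, none of the following three classes of frames is modally definable: the class of all transitive frames, the class of all Euclidean frames, the class of all deterministic frames.
   Context: Syntax. $\mathbf{At}=\{p_i : i\in\mathbb{N}\}$ is a countable set of atoms (enumerated without repetition). The set $\mathbf{Fo}$ of formulas is generated by $A ::= p \mid (A\rightharpoonup A)\mid (A\leftharpoondown A)\mid \top\mid\bot\mid (A\vee A)\mid (A\wedge A)\mid \lozenge A\mid\square A\mid⧫ A\mid\blacksquare A$, with $p\in\mathbf{At}$. A signed formula is a pair $(\alpha,A)$ with $\alpha\in\{+,-\}$ and $A\in\mathbf{Fo}$. Semantics. A frame is a triple $(W,\leq,R)$ where $W\neq\emptyset$, $\leq$ is a preorder on $W$ and $R$ is a binary relation on $W$; $\geq$ is the converse of $\leq$. A valuation is a function $V:\mathbf{At}\to\wp(W)$ such that each $V(p)$ is $\leq$-closed (if $s\in V(p)$ and $s\leq t$ then $t\in V(p)$). A model based on $(W,\leq,R)$ is $(W,\leq,R,V)$ with $V$ a valuation. Satisfaction at $s\in W$: $s\models p$ iff $s\in V(p)$; $s\models\top$; $s\not\models\bot$; $\vee,\wedge$ as usual pointwise; - $s\models A\rightharpoonup B$ iff for all $t\geq s$, $t\not\models A$ or $t\models B$; - $s\models A\leftharpoondown B$ iff there is $t\leq s$ with $t\not\models A$ and $t\models B$; - $s\models\lozenge A$ iff there are $t\leq s$ and $u$ with $tRu$ and $u\models A$; - $s\models\square A$ iff for all $t\geq s$ and all $u$, $tRu$ implies $u\models A$; - $s\models⧫ A$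 iff for all $t\geq s$ there is $u$ with $tRu$ and $u\models A$; - $s\models\blacksquare A$ iff there is $t\leq s$ such that for all $u$, $tRu$ implies $u\models A$. Further, $s\models(+,A)$ iff $s\models A$, and $s\models(-,A)$ iff $s\not\models A$. A signed formula is valid in a frame if it is satisfied at every point of every model based on the frame. Composition: $s(R\circ S)t$ iff there is $u$ with $sRu$ and $uSt$. A frame is forward confluent if ${\geq}\circ R\subseteq R\circ{\geq}$; backward confluent if $R\circ{\leq}\subseteq{\leq}\circ R$; downward confluent if ${\leq}\circ R\subseteq R\circ{\leq}$; upward confluent if $R\circ{\geq}\subseteq{\geq}\circ R$. It is transitive if $sRt$ and $tRu$ imply $sRu$; Euclidean if $sRt$ and $sRu$ imply $tRu$; deterministic if $sRt$ and $sRu$ imply $t=u$ (for all $s,t,u\in W$). Definability. An inference rule consists of $m\in\mathbb{N}$ signed formulas $(\alpha_1,A_1),\dots,(\alpha_m,A_m)$ (premises) and a signed formula $(\beta,B)$ (conclusion). A frame respects the rule if: whenever all premises are valid in the frame, the conclusion is valid in the frame. A class $\mathcal{C}$ of frames is modally definable with respect to a class $\mathcal{D}$ of frames if there is an inference rule such that every frame in $\mathcal{D}$ respects the rule iff it is in $\mathcal{C}$. -}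

module Defs where

open import Data.Empty.Polymorphic using (⊥)
open import Data.List.Base using (List)
open import Data.List.Relation.Unary.All using (All)
open import Data.Nat.Base using (ℕ)
open import Data.Product.Base using (_×_; _,_; ∃-syntax)
open import Data.Sign.Base using (Sign; +; -)
open import Data.Sum.Base using (_⊎_)
open import Data.Unit.Polymorphic using (⊤)
open import Function.Base using (flip)
open import Function.Bundles using (_⇔_)
open import Level using (Level; suc)
open import Relation.Binary.Construct.Composition
  using () renaming (_;_ to _⨾_)
open import Relation.Binary.Core using (Rel; _⇒_)
open import Relation.Binary.Definitions using (Transitive; _Respects_)
open import Relation.Binary.PropositionalEquality.Core using (_≡_)
open import Relation.Binary.Structures using (IsPreorder)
open import Relation.Nullary.Negation.Core using (¬_)
open import Relation.Unary using (Pred; _∈_)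

private
  variable
    ℓ : Level

At : Set
At = ℕ

infixr 5 _⇀_ _↽_
infixr 6 _∨_
infixr 7 _∧_
infix  8 ◊_ □_ ⧫_ ■_

data Fo : Set where
  atom          : At → Fo
  _⇀_ _↽_       : Fo → Fo → Fo
  top bot       : Fo
  _∨_ _∧_       : Fo → Fo → Fo
  ◊_ □_ ⧫_ ■_   : Fo → Fo

SignedFo : Set
SignedFo = Sign × Fo

record Frame (ℓ : Level) : Set (suc ℓ) where
  infix 4 _≤_ _≥_
  field
    W          : Set ℓ
    _≤_        : Rel W ℓ
    R          : Rel W ℓ
    inhabitant : W
    isPreorder : IsPreorder _≡_ _≤_

  _≥_ : Rel W ℓ
  _≥_ = flip _≤_

-- Subsets of W are predicates valued in arbitrary types, so they are not
-- assumed decidable.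
record Valuation (F : Frame ℓ) : Set (suc ℓ) where
  open Frame F
  field
    V      : At → Pred W ℓ
    closed : ∀ p → V p Respects _≤_

module _ (F : Frame ℓ) (val : Valuation F) where
  open Frame F
  open Valuation val

  -- The clause for _⇀_ is a disjunction under the quantifier; without excluded
  -- middle this is stronger than Sat t A → Sat t B.
  Sat : W → Fo → Set ℓ
  Sat s (atom p) = s ∈ V p
  Sat s (A ⇀ B)  = ∀ t → t ≥ s → ¬ Sat t A ⊎ Sat t B
  Sat s (A ↽ B)  = ∃[ t ] (t ≤ s × ¬ Sat t A × Sat t B)
  Sat s top      = ⊤
  Sat s bot      = ⊥
  Sat s (A ∨ B)  = Sat s A ⊎ Sat s B
  Sat s (A ∧ B)  = Sat s A × Sat s B
  Sat s (◊ A)    = ∃[ t ] ∃[ u ] (t ≤ s × R t u × Sat u A)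
  Sat s (□ A)    = ∀ t → t ≥ s → ∀ u → R t u → Sat u A
  Sat s (⧫ A)    = ∀ t → t ≥ s → ∃[ u ] (R t u × Sat u A)
  Sat s (■ A)    = ∃[ t ] (t ≤ s × (∀ u → R t u → Sat u A))

  SatSigned : W → SignedFo → Set ℓ
  SatSigned s (+ , A) = Sat s A
  SatSigned s (- , A) = ¬ Sat s A

Valid : Frame ℓ → SignedFo → Set (suc ℓ)
Valid F φ = ∀ (val : Valuation F) (s : Frame.W F) → SatSigned F val s φ

record Rule : Set where
  field
    premises   : List SignedFo
    conclusion : SignedFo

RespectsRule : Frame ℓ → Rule → Set (suc ℓ)
RespectsRule F ρ = All (Valid F) premises → Valid F conclusion
  where open Rule ρ

module _ {c d : Level} where

  ModallyDefinable : (C : Pred (Frame ℓ) c) (D : Pred (Frame ℓ) d) → Set _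
  ModallyDefinable C D =
    ∃[ ρ ] (∀ F → F ∈ D → RespectsRule F ρ ⇔ F ∈ C)

module _ (F : Frame ℓ) where
  open Frame F

  ForwardConfluent : Set ℓ
  ForwardConfluent = (_≥_ ⨾ R) ⇒ (R ⨾ _≥_)

  BackwardConfluent : Set ℓ
  BackwardConfluent = (R ⨾ _≤_) ⇒ (_≤_ ⨾ R)

  DownwardConfluent : Set ℓ
  DownwardConfluent = (_≤_ ⨾ R) ⇒ (R ⨾ _≤_)

  UpwardConfluent : Set ℓ
  UpwardConfluent = (R ⨾ _≥_) ⇒ (_≥_ ⨾ R)

  FullyConfluent : Set ℓ
  FullyConfluent =
    ForwardConfluent × BackwardConfluent × DownwardConfluent × UpwardConfluent

  TransitiveFrame : Set ℓ
  TransitiveFrame = Transitive R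

  EuclideanFrame : Set ℓ
  EuclideanFrame = ∀ {s t u} → R s t → R s u → R t u

  DeterministicFrame : Set ℓ
  DeterministicFrame = ∀ {s t u} → R s t → R s u → t ≡ u

{-# OPTIONS --safe #-}

-- When ≤ relates all points and R is serial, every formula has the same truth
-- value at all points, and this value depends only on the constant truth values
-- of the atoms. Hence all such frames validate the same signed formulas. One of
-- them is the reflexive point, which is transitive, Euclidean and deterministic;
-- another consists of two points x, y with R relating every pair except (y , y),
-- and has none of the three properties.
module Submission where

open import Defs
import Data.List.Relation.Unary.All as All
open import Data.Product.Base using (_×_; _,_; ∃-syntax)
open import Data.Sign.Base using (+; -)
open import Data.Sum.Base as Sum using (_⊎_; inj₁; inj₂)
open import Data.Unit.Polymorphic using (⊤; tt)
open import Function.Base using (_∘_)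
open import Function.Bundles using (module Equivalence)
open import Level using (Level)
open import Relation.Binary.Definitions using (Universal)
open import Relation.Binary.PropositionalEquality.Core using (_≡_; refl)
open import Relation.Binary.PropositionalEquality.Properties using (isEquivalence)
open import Relation.Nullary.Negation.Core using (¬_)
open import Relation.Unary using (Pred; _∈_; _∉_)

private
  variable
    ℓ c d : Level

-- `universal` and `serial` carry the transfer of truth; `surjective` is there for backward and
-- upward confluence.
record IsCluster (F : Frame ℓ) : Set ℓ where
  open Frame F
  field
    universal  : Universal _≤_
    serial     : ∀ s → ∃[ t ] R s t
    surjective : ∀ t → ∃[ s ] R s t

-- As `_≤_` relates all points, each condition only asks for some `R`-arrow out of `s` or into `u`.
cluster-confluent : {F : Frame ℓ} → IsCluster F → FullyConfluent F
cluster-confluent K =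
    (λ {s} {u} _ → let v , r = serial s in v , r , universal u v)
  , (λ {s} {u} _ → let w , r = surjective u in w , universal s w , r)
  , (λ {s} {u} _ → let v , r = serial s in v , r , universal v u)
  , (λ {s} {u} _ → let w , r = surjective u in w , universal w s , r)
  where open IsCluster K

-- Since `s` and `t` are unrelated, inclusions both ways force every atom to be constant, with one
-- value in both models.
SubValuation : {F G : Frame ℓ} → Valuation F → Valuation G → Set ℓ
SubValuation v w = ∀ p s t → Valuation.V v p s → Valuation.V w p t

Sat-transfer : {F G : Frame ℓ} → IsCluster F → IsCluster G →
               {v : Valuation F} {w : Valuation G} →
               SubValuation v w → SubValuation w v →
               ∀ A {s t} → Sat F v s A → Sat G w t A
Sat-transfer {F = F} {G} K L {v} {w} v⊆w w⊆v = go
  where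
  module K = IsCluster K
  module L = IsCluster L

  go : ∀ A {s t} → Sat F v s A → Sat G w t A

  -- Left arguments of `⇀` and `↽` occur negatively, so the induction calls itself with the two
  -- frames exchanged.
  back : ∀ A {s t} → Sat G w t A → Sat F v s A
  back A = Sat-transfer L K w⊆v v⊆w A

  go (atom p) {s} {t} x         = v⊆w p s t x
  go (A ⇀ B)  {s} h _ _         = Sum.map (_∘ back A) (go B) (h s (K.universal s s))
  go (A ↽ B)  {t = t} (_ , _ , ¬a , b) =
    t , L.universal t t , ¬a ∘ back A , go B b
  go top      _                 = tt
  go (A ∨ B)  x                 = Sum.map (go A) (go B) x
  go (A ∧ B)  (a , b)           = go A a , go B b
  go (◊ A)    {t = t} (_ , _ , _ , _ , a) =
    let u , r = L.serial t in t , u , L.universal t t , r , go A a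
  -- Seriality keeps `□ A` from holding vacuously: a successor `u` of `s` satisfies `A`, hence so
  -- does every point of `G`. The same works for `■ A`.
  go (□ A)    {s} h _ _ _ _     =
    let u , r = K.serial s in go A (h s (K.universal s s) u r)
  go (⧫ A)    {s} h t _         =
    let u , r = L.serial t
        _ , _ , a = h s (K.universal s s)
    in u , r , go A a
  go (■ A)    {t = t} (s , _ , h) =
    let u , r = K.serial s in t , L.universal t t , λ _ _ → go A (h u r)

-- Closure under a universal preorder makes `w` constant, so its values at `t` can be copied to all
-- of `F`, where validity applies.
Valid-transfer : {F G : Frame ℓ} → IsCluster F → IsCluster G →
                 ∀ φ → Valid F φ → Valid G φ
Valid-transfer {F = F} {G} K L φ valid w t = signed φ (valid v (Frame.inhabitant F))
  where
  v : Valuation F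
  v = record { V = λ p _ → Valuation.V w p t ; closed = λ _ _ x → x }

  v⊆w : SubValuation v w
  v⊆w p _ u = Valuation.closed w p (IsCluster.universal L t u)

  w⊆v : SubValuation w v
  w⊆v p u _ = Valuation.closed w p (IsCluster.universal L u t)

  signed : ∀ φ {s} → SatSigned F v s φ → SatSigned G w t φ
  signed (+ , A) = Sat-transfer K L v⊆w w⊆v A
  signed (- , A) = _∘ Sat-transfer L K w⊆v v⊆w A

RespectsRule-transfer : {F G : Frame ℓ} → IsCluster F → IsCluster G →
                        ∀ ρ → RespectsRule F ρ → RespectsRule G ρ
RespectsRule-transfer K L ρ respects =
  Valid-transfer K L (Rule.conclusion ρ) ∘ respects ∘
  All.map (λ {φ} → Valid-transfer L K φ)

-- Both clusters are fully confluent and respect the same rules, so no rule can separate them.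
clusters-undefinable : {C : Pred (Frame ℓ) c} {F G : Frame ℓ} →
                       IsCluster F → IsCluster G → F ∈ C → G ∉ C →
                       ¬ ModallyDefinable C FullyConfluent
clusters-undefinable {F = F} {G} K L F∈C G∉C (ρ , defines) =
  G∉C (to (defines G (cluster-confluent L))
    (RespectsRule-transfer K L ρ
      (from (defines F (cluster-confluent K)) F∈C)))
  where open Equivalence

indiscrete : {W : Set ℓ} → W → (W → W → Set ℓ) → Frame ℓ
indiscrete {W = W} x R = record
  { W          = W
  ; _≤_        = λ _ _ → ⊤
  ; R          = R
  ; inhabitant = x
  ; isPreorder = record
    { isEquivalence = isEquivalence
    ; reflexive     = λ _ → tt
    ; trans         = λ _ _ → tt
    }
  }

point : Frame ℓ
point = indiscrete {W = ⊤} tt (λ _ _ → ⊤)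

point-isCluster : IsCluster {ℓ} point
point-isCluster = record
  { universal  = λ _ _ → tt
  ; serial     = λ _ → tt , tt
  ; surjective = λ _ → tt , tt
  }

data Two {ℓ : Level} : Set ℓ where
  x y : Two

two : Frame ℓ
two = indiscrete x (λ s t → s ≡ x ⊎ t ≡ x)

two-isCluster : IsCluster {ℓ} two
two-isCluster = record
  { universal  = λ _ _ → tt
  ; serial     = λ _ → x , inj₂ refl
  ; surjective = λ _ → x , inj₁ refl
  }

¬Ryy : ¬ Frame.R (two {ℓ}) y y
¬Ryy (inj₁ ())
¬Ryy (inj₂ ())

two-not-deterministic : ¬ DeterministicFrame (two {ℓ})
two-not-deterministic det with det {x} {x} {y} (inj₁ refl) (inj₁ refl)
... | ()

proposition28 : ∀ (ℓ : Level) →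
    ¬ ModallyDefinable {ℓ = ℓ} TransitiveFrame FullyConfluent
    × ¬ ModallyDefinable {ℓ = ℓ} EuclideanFrame FullyConfluent
    × ¬ ModallyDefinable {ℓ = ℓ} DeterministicFrame FullyConfluent
proposition28 ℓ =
    clusters-undefinable point-isCluster two-isCluster (λ {_} {_} {_} _ _ → tt)
      -- The path from `y` through `x` back to `y` would yield a loop at `y`.
      (λ trans → ¬Ryy (trans {y} {x} {y} (inj₂ refl) (inj₁ refl)))
  , clusters-undefinable point-isCluster two-isCluster (λ {_} {_} {_} _ _ → tt)
      -- Taking `y` for both successors of `x` would again yield that loop.
      (λ euclidean → ¬Ryy (euclidean {x} {y} {y} (inj₁ refl) (inj₁ refl)))
  , clusters-undefinable point-isCluster two-isCluster (λ {_} {_} {_} _ _ → refl)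
      two-not-deterministic
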